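{- Let $G$ be a cubic bipartite graph with $2k$ vertices and a proper 3-edge-coloring. Then the number of faces of the faithful embedding of $G$ relative to the 3-coloring has the same parity as $k$. Consequently, if $M$ is an orientable map, then $\chi(M)$ is even.
   Context: A proper 3-edge-coloring (colors $a,b,c$) of a cubic graph gives the $ab$-, $bc$-, $ca$-polygons (cycles of edges of two colors); the faithful embedding is obtained by attaching a disc along each such polygon, so its faces correspond to these polygons. A map is a triple $M=(C_M,v_M,f_M)$ where $C_M$ is a finite cubic graph and $v_M,f_M$ are disjoint perfect matchings whose union is a disjoint union of 4-cycles (squares, set $SQ(M)$); $a_M$ is the third perfect matching; $\chi(M)=|vG(M)|-|SQ(M)|+|fG(M)|$ where $vG(M)$, $fG(M)$ are the sets of cycles of $v_M\cup a_M$ and $f_M\cup a_M$. $M$ is orientable if $C_M$ is bipartite. -}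

module Defs where

open import Data.Bool using (Bool)
open import Data.Fin using (Fin; toℕ; _≟_)
open import Data.Fin.Patterns using (0F; 1F; 2F)
open import Data.Fin.Properties using (any?; all?; toℕ<n; toℕ-injective)
open import Data.Fin.Subset
  using (Subset; inside; outside; _∈_; _⊆_; _∩_; _∪_; ∁; ⊤; ⋃; ∣_∣; Nonempty; Empty)
open import Data.Fin.Subset.Properties using (_∈?_; _⊆?_; nonempty?)
open import Data.Integer using (ℤ; +_) renaming (_+_ to _+ℤ_; _-_ to _-ℤ_)
open import Data.List using (List; []; _∷_; _++_; map; filter; length)
open import Data.List.Relation.Unary.All using (All)
open import Data.List.Relation.Unary.AllPairs using (AllPairs)
open import Data.Nat using (ℕ; zero; suc; _+_; _<_)
import Data.Nat as ℕ
open import Data.Nat.Properties using (m<1+n⇒m<n∨m≡n)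
open import Data.Product using (∃; _×_; _,_; proj₁; proj₂)
open import Data.Sum using (_⊎_; inj₁; inj₂)
open import Data.Vec using (tabulate; []; _∷_)
open import Relation.Binary.Construct.Closure.ReflexiveTransitive using (Star; ε; _◅_; _◅◅_)
open import Relation.Binary.PropositionalEquality using (_≡_; _≢_; refl; sym; trans)
open import Relation.Nullary using (Dec; does; ¬_)
open import Relation.Nullary.Decidable using (map′; _×-dec_; _⊎-dec_; _→-dec_)

-- Reachability for a decidable relation on a finite set is decidable
-- (Warshall's algorithm): Via k x y says that y can be reached from x by a
-- walk all of whose intermediate points are smaller than k.

module Reachability {n : ℕ} {R : Fin n → Fin n → Set} (R? : ∀ x y → Dec (R x y)) where

  data Via : ℕ → Fin n → Fin n → Set where
    stay : ∀ {x} → Via 0 x x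
    step : ∀ {x y} → R x y → Via 0 x y
    lift : ∀ {k x y} → Via k x y → Via (suc k) x y
    join : ∀ {k x z y} → toℕ z ≡ k → Via k x z → Via k z y → Via (suc k) x y

  via? : ∀ k x y → Dec (Via k x y)
  via? zero x y = map′
    (λ { (inj₁ refl) → stay ; (inj₂ r) → step r })
    (λ { stay → inj₁ refl ; (step r) → inj₂ r })
    ((x ≟ y) ⊎-dec R? x y)
  via? (suc k) x y = map′
    (λ { (inj₁ p) → lift p ; (inj₂ (_ , e , p , q)) → join e p q })
    (λ { (lift p) → inj₁ p ; (join e p q) → inj₂ (_ , e , p , q) })
    (via? k x y ⊎-dec
     any? (λ z → (toℕ z ℕ.≟ k) ×-dec (via? k x z ×-dec via? k z y)))

  via⇒star : ∀ {k x y} → Via k x y → Star R x y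
  via⇒star stay         = ε
  via⇒star (step r)     = r ◅ ε
  via⇒star (lift p)     = via⇒star p
  via⇒star (join _ p q) = via⇒star p ◅◅ via⇒star q

  liftAll : ∀ k {x y} → Via 0 x y → Via k x y
  liftAll zero    p = p
  liftAll (suc k) p = lift (liftAll k p)

  via-into : ∀ {k x z} → toℕ z ≡ k → Via (suc k) x z → Via k x z
  via-into e (lift p) = p
  via-into e (join e′ p q) with toℕ-injective (trans e (sym e′))
  ... | refl = p

  via-from : ∀ {k z y} → toℕ z ≡ k → Via (suc k) z y → Via k z y
  via-from e (lift p) = p
  via-from e (join e′ p q) with toℕ-injective (trans e (sym e′))
  ... | refl = q

  via-trans : ∀ k {x z y} → toℕ z < k → Via k x z → Via k z y → Via k x y
  via-trans (suc k) z<1+k p q with m<1+n⇒m<n∨m≡n z<1+k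
  via-trans (suc k) _ p q | inj₂ e = join e (via-into e p) (via-from e q)
  via-trans (suc k) _ (lift p) (lift q) | inj₁ z<k = lift (via-trans k z<k p q)
  via-trans (suc k) _ (lift p) (join e q q′) | inj₁ z<k = join e (via-trans k z<k p q) q′
  via-trans (suc k) _ (join e p p′) (lift q) | inj₁ z<k = join e p (via-trans k z<k p′ q)
  via-trans (suc k) _ (join e p p′) (join e′ q q′) | inj₁ _
    with toℕ-injective (trans e (sym e′))
  ... | refl = join e p q′

  star⇒via : ∀ {x y} → Star R x y → Via n x y
  star⇒via ε       = liftAll n stay
  star⇒via (_◅_ {j = z} r rs) = via-trans n (toℕ<n z) (liftAll n (step r)) (star⇒via rs)

  star? : ∀ x y → Dec (Star R x y)
  star? x y = map′ via⇒star star⇒via (via? n x y)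

-- Finite undirected graphs; parallel edges and loops are allowed, and the order
-- of the two ends of an edge carries no meaning.

record Graph : Set where
  field
    ∣V∣ ∣E∣ : ℕ
    ends    : Fin ∣E∣ → Fin ∣V∣ × Fin ∣V∣

module _ (G : Graph) where
  open Graph G

  Vertex : Set
  Vertex = Fin ∣V∣

  Edge : Set
  Edge = Fin ∣E∣

  EdgeSet : Set
  EdgeSet = Subset ∣E∣

  Incident : Edge → Vertex → Set
  Incident e x = proj₁ (ends e) ≡ x ⊎ proj₂ (ends e) ≡ x

  Joins : Edge → Vertex → Vertex → Set
  Joins e x y = (proj₁ (ends e) ≡ x × proj₂ (ends e) ≡ y)
              ⊎ (proj₁ (ends e) ≡ y × proj₂ (ends e) ≡ x)

  -- The two summands count the two kinds of ends, so a loop counts twice.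
  degree : EdgeSet → Vertex → ℕ
  degree S x = ∣ S ∩ tabulate (λ e → does (proj₁ (ends e) ≟ x)) ∣
             + ∣ S ∩ tabulate (λ e → does (proj₂ (ends e) ≟ x)) ∣

  Cubic : Set
  Cubic = ∀ x → degree ⊤ x ≡ 3

  Bipartite : Set
  Bipartite = ∃ λ (side : Vertex → Bool) → ∀ e → side (proj₁ (ends e)) ≢ side (proj₂ (ends e))

  PerfectMatching : EdgeSet → Set
  PerfectMatching S = ∀ x → degree S x ≡ 1

  Covers : EdgeSet → Vertex → Set
  Covers S x = ∃ λ e → e ∈ S × Incident e x

  Adjacent : EdgeSet → Vertex → Vertex → Set
  Adjacent S x y = ∃ λ e → e ∈ S × Joins e x y

  Connected : EdgeSet → Set
  Connected S = ∀ x y → Covers S x → Covers S y → Star (Adjacent S) x y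

  -- A cycle (polygon) is a nonempty connected subgraph, regular of degree 2,
  -- identified with its set of edges.  Two parallel edges form a cycle.
  Cycle : EdgeSet → Set
  Cycle S = Nonempty S × (∀ x → Covers S x → degree S x ≡ 2) × Connected S

  covers? : ∀ S x → Dec (Covers S x)
  covers? S x = any? λ e → (e ∈? S) ×-dec ((proj₁ (ends e) ≟ x) ⊎-dec (proj₂ (ends e) ≟ x))

  adjacent? : ∀ S x y → Dec (Adjacent S x y)
  adjacent? S x y = any? λ e → (e ∈? S) ×-dec
    (((proj₁ (ends e) ≟ x) ×-dec (proj₂ (ends e) ≟ y)) ⊎-dec
     ((proj₁ (ends e) ≟ y) ×-dec (proj₂ (ends e) ≟ x)))

  connected? : ∀ S → Dec (Connected S)
  connected? S = all? λ x → all? λ y →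
    covers? S x →-dec (covers? S y →-dec Reachability.star? (adjacent? S) x y)

  cycle? : ∀ S → Dec (Cycle S)
  cycle? S = nonempty? S ×-dec
    ((all? λ x → covers? S x →-dec (degree S x ℕ.≟ 2)) ×-dec connected? S)

-- Every subset of Fin n, listed exactly once.
subsets : ∀ n → List (Subset n)
subsets zero    = [] ∷ []
subsets (suc n) = map (outside ∷_) (subsets n) ++ map (inside ∷_) (subsets n)

cyclesIn : (G : Graph) → EdgeSet G → List (EdgeSet G)
cyclesIn G X = filter (λ S → cycle? G S ×-dec (S ⊆? X)) (subsets (Graph.∣E∣ G))

-- The three colors a, b, c are 0F, 1F, 2F.

Coloring : Graph → Set
Coloring G = Edge G → Fin 3

Proper : (G : Graph) → Coloring G → Set
Proper G col = ∀ e e′ x → e ≢ e′ → Incident G e x → Incident G e′ x → col e ≢ col e′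

colorClass : (G : Graph) → Coloring G → Fin 3 → EdgeSet G
colorClass G col i = tabulate (λ e → does (col e ≟ i))

polygons : (G : Graph) → Coloring G → Fin 3 → Fin 3 → List (EdgeSet G)
polygons G col i j = cyclesIn G (colorClass G col i ∪ colorClass G col j)

-- A graph with discs attached along cycles, each disc given by its boundary.

record DiscComplex : Set where
  field
    skeleton : Graph
    discs    : List (EdgeSet skeleton)

numberOfFaces : DiscComplex → ℕ
numberOfFaces K = length (DiscComplex.discs K)

faithfulEmbedding : (G : Graph) → Coloring G → DiscComplex
faithfulEmbedding G col = record
  { skeleton = G
  ; discs    = polygons G col 0F 1F ++ polygons G col 1F 2F ++ polygons G col 2F 0F
  }

FourCycle : (G : Graph) → EdgeSet G → Set
FourCycle G S = Cycle G S × ∣ S ∣ ≡ 4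

VertexDisjoint : (G : Graph) → EdgeSet G → EdgeSet G → Set
VertexDisjoint G S T = ∀ x → Covers G S x → ¬ Covers G T x

DisjointUnionOfFourCycles : (G : Graph) → EdgeSet G → Set
DisjointUnionOfFourCycles G X = ∃ λ (Ss : List (EdgeSet G)) →
  All (FourCycle G) Ss × AllPairs (VertexDisjoint G) Ss × ⋃ Ss ≡ X

record GraphMap : Set where
  field
    C          : Graph
    cubic      : Cubic C
    v f        : EdgeSet C
    v-matching : PerfectMatching C v
    f-matching : PerfectMatching C f
    v∩f-empty  : Empty (v ∩ f)
    v∪f-square : DisjointUnionOfFourCycles C (v ∪ f)

  -- The third perfect matching: v and f are disjoint and C is cubic.
  a : EdgeSet C
  a = ∁ (v ∪ f)

  vG fG SQ : List (EdgeSet C)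
  vG = cyclesIn C (v ∪ a)
  fG = cyclesIn C (f ∪ a)
  SQ = cyclesIn C (v ∪ f)

  χ : ℤ
  χ = (+ length vG -ℤ + length SQ) +ℤ + length fG

  Orientable : Set
  Orientable = Bipartite C

{-# OPTIONS --safe #-}

-- For perfect matchings A and B of a bipartite graph, let crossing A B be the permutation of
-- the vertices that moves one side of the bipartition along A and the other side along B.
-- Its orbits are the vertex sets of the cycles in A ∪ B.  Applying crossing A B, crossing B C
-- and crossing C A in turn gives crossing A A, an involution with k orbits.  A transposition
-- changes the number of orbits by one, so on an even number of points the parity of the
-- number of orbits is additive under composition; hence the three cycle counts add up to k
-- modulo 2.  For an orientable map, v ∪ f has as many edges as there are vertices and is a
-- disjoint union of squares, so the number 2k of vertices is a multiple of 4.

module Submission where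

open import Defs
open import Algebra.Properties.CommutativeSemigroup using (interchange)
open import Data.Bool using (Bool; true; false; not; if_then_else_)
import Data.Bool as Bool
import Data.Bool.Properties as Bool
open import Data.Fin using (Fin; zero; suc; toℕ; _≟_; punchIn; punchOut)
open import Data.Fin.Patterns using (0F; 1F; 2F)
open import Data.Fin.Permutation as Perm using (Permutation′; _⟨$⟩ʳ_; _⟨$⟩ˡ_; _∘ₚ_; transpose)
open import Data.Fin.Permutation.Transposition.List using (eval; decompose; eval-decompose)
import Data.Fin.Properties as Fin
open import Data.Fin.Subset
  using (Subset; inside; outside; _∈_; _∉_; _⊆_; _∩_; _∪_; ⊤; ⊥; ⁅_⁆; ⋃; ∣_∣; Empty)
import Data.Fin.Subset.Properties as Subset
open import Data.Integer using (+_)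
import Data.Integer as ℤ
open import Data.Integer.Divisibility using (_∣_)
import Data.Integer.Divisibility.Signed as Signed
import Data.Integer.Solver as ℤ
open import Data.List using (List; []; _∷_; map; length; lookup)
open import Data.List.Membership.Propositional using () renaming (_∈_ to _∈ˡ_)
open import Data.List.Membership.Propositional.Properties
  using (∈-++⁺ˡ; ∈-++⁺ʳ; ∈-map⁺; ∈-map⁻; ∈-filter⁺; ∈-filter⁻; ∈-lookup)
open import Data.List.Properties using (length-++)
open import Data.List.Relation.Unary.All as All using (All; []; _∷_)
open import Data.List.Relation.Unary.AllPairs using (AllPairs; []; _∷_)
open import Data.List.Relation.Unary.Any as Any using (here)
open import Data.List.Relation.Unary.Any.Properties using (lookup-index)
open import Data.List.Relation.Unary.Unique.Propositional using (Unique)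
import Data.List.Relation.Unary.Unique.Propositional.Properties as Unique
open import Data.Nat using (ℕ; zero; suc; _≤_; _<_; _+_; _*_; parity; z≤n; s≤s)
import Data.Nat.Divisibility as ℕ
open import Data.Nat.GeneralisedArithmetic using (fold)
import Data.Nat.Properties as ℕ
import Data.Nat.Solver as ℕ
open import Data.Parity as ℙ using (0ℙ; 1ℙ; _⁻¹)
import Data.Parity.Properties as ℙ
open import Data.Product using (∃; _×_; _,_; proj₁; proj₂)
open import Data.Product.Function.NonDependent.Propositional using (_×-↔_)
open import Data.Sum as ⊎ using (_⊎_; inj₁; inj₂; swap)
open import Data.Vec using (tabulate; []; _∷_) renaming (here to hereᵛ)
open import Data.Vec.Properties using (lookup∘tabulate; lookup⇒[]=; []=⇒lookup; ∷-injectiveʳ)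
open import Function using (_∘_; mk↔ₛ′)
open import Function.Construct.Composition using (_↔-∘_)
open import Function.Construct.Identity using (↔-id)
open import Function.Construct.Symmetry using (↔-sym)
open import Level using (0ℓ)
open import Relation.Binary using (Rel; _⇒_; Decidable; IsEquivalence)
open import Relation.Binary.Construct.Closure.ReflexiveTransitive as Star using (Star; ε; _◅_; _◅◅_)
open import Relation.Binary.PropositionalEquality
open import Relation.Nullary using (Dec; does; ¬_; yes; no; contradiction)
open import Relation.Nullary.Decidable using (dec-true; dec-false; _×-dec_)

open import Algebra.Properties.CommutativeMonoid.Sum ℕ.+-0-commutativeMonoid
  using (sum; ∑-distrib-+; sum-cong-≗)

private
  variable
    m n c d : ℕ

-- Counting equivalence classes

-- Encodes that `S` is an equivalence relation with exactly `c` classes: `index` is the quotient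
-- map, `rep` a section of it. Counts obtained in different ways can then be compared through their
-- relations alone.
record Classes {n} (S : Rel (Fin n) 0ℓ) (c : ℕ) : Set where
  field
    index    : Fin n → Fin c
    rep      : Fin c → Fin n
    index-rep : ∀ k → index (rep k) ≡ k
    sound    : ∀ {x y} → S x y → index x ≡ index y
    complete : ∀ {x y} → index x ≡ index y → S x y

module _ {S T : Rel (Fin n) 0ℓ} where

  -- The `T`-class of a representative determines its `S`-class, so choosing representatives injects
  -- the classes of the coarser relation into those of the finer one.
  Classes-≤ : T ⇒ S → Classes S c → Classes T d → c ≤ d
  Classes-≤ T⇒S cs ds = Fin.injective⇒≤ {f = D.index ∘ C.rep} λ {k} {l} eq →
    trans (sym (C.index-rep k)) (trans (C.sound (T⇒S (D.complete eq))) (C.index-rep l))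
    where
    module C = Classes cs
    module D = Classes ds

Classes-unique : {S T : Rel (Fin n) 0ℓ} → S ⇒ T → T ⇒ S → Classes S c → Classes T d → c ≡ d
Classes-unique S⇒T T⇒S cs ds = ℕ.≤-antisym (Classes-≤ T⇒S cs ds) (Classes-≤ S⇒T ds cs)

-- Induction on the number of points: `zero` either joins the class of a later point related to it
-- or opens a class of its own.
classes : {S : Rel (Fin n) 0ℓ} → Decidable S → IsEquivalence S → ∃ (Classes S)
classes {zero} S? eq = 0 , record
  { index = λ () ; rep = λ () ; index-rep = λ () ; sound = λ { {()} } ; complete = λ { {()} } }
classes {suc n} {S} S? eq
  with classes {n} {λ x y → S (suc x) (suc y)} (λ x y → S? (suc x) (suc y))
         (record { refl = IsEquivalence.refl eq
                 ; sym = IsEquivalence.sym eq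
                 ; trans = IsEquivalence.trans eq })
     | Fin.any? (λ x → S? zero (suc x))
... | c , cs | yes (z , 0~z) = c , record
  { index = index ; rep = suc ∘ C.rep ; index-rep = C.index-rep ; sound = sound ; complete = complete }
  where
  module C = Classes cs
  open IsEquivalence eq using () renaming (refl to refl~; sym to sym~; trans to trans~)
  index : Fin (suc n) → Fin c
  index zero    = C.index z
  index (suc x) = C.index x
  sound : ∀ {x y} → S x y → index x ≡ index y
  sound {zero}  {zero}  p = refl
  sound {zero}  {suc y} p = C.sound (trans~ (sym~ 0~z) p)
  sound {suc x} {zero}  p = C.sound (trans~ p 0~z)
  sound {suc x} {suc y} p = C.sound p
  complete : ∀ {x y} → index x ≡ index y → S x y
  complete {zero}  {zero}  e = refl~
  complete {zero}  {suc y} e = trans~ 0~z (C.complete e)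
  complete {suc x} {zero}  e = trans~ (C.complete e) (sym~ 0~z)
  complete {suc x} {suc y} e = C.complete e
... | c , cs | no 0≁ = suc c , record
  { index = index ; rep = rep ; index-rep = index-rep ; sound = sound ; complete = complete }
  where
  module C = Classes cs
  open IsEquivalence eq using () renaming (refl to refl~; sym to sym~)
  index : Fin (suc n) → Fin (suc c)
  index zero    = zero
  index (suc x) = suc (C.index x)
  rep : Fin (suc c) → Fin (suc n)
  rep zero    = zero
  rep (suc k) = suc (C.rep k)
  index-rep : ∀ k → index (rep k) ≡ k
  index-rep zero    = refl
  index-rep (suc k) = cong suc (C.index-rep k)
  sound : ∀ {x y} → S x y → index x ≡ index y
  sound {zero}  {zero}  p = refl
  sound {zero}  {suc y} p = contradiction (y , p) 0≁
  sound {suc x} {zero}  p = contradiction (x , sym~ p) 0≁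
  sound {suc x} {suc y} p = cong suc (C.sound p)
  complete : ∀ {x y} → index x ≡ index y → S x y
  complete {zero}  {zero}  e = refl~
  complete {zero}  {suc y} ()
  complete {suc x} {zero}  ()
  complete {suc x} {suc y} e = C.complete (Fin.suc-injective e)

module Merge {a b : Fin (suc n)} (a≢b : a ≢ b) where

  -- The quotient map gluing `a` to `b`: `a` takes the value of `b`, and the other points are
  -- renumbered with `a` left out.
  merge : Fin (suc n) → Fin n
  merge k with a ≟ k
  ... | yes _   = punchOut a≢b
  ... | no  a≢k = punchOut a≢k

  merge-a≡merge-b : merge a ≡ merge b
  merge-a≡merge-b with a ≟ a | a ≟ b
  ... | no a≢a | _       = contradiction refl a≢a
  ... | yes _  | yes a≡b = contradiction a≡b a≢b
  ... | yes _  | no _    = Fin.punchOut-cong a refl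

  merge-punchIn : ∀ k → merge (punchIn a k) ≡ k
  merge-punchIn k with a ≟ punchIn a k
  ... | yes e = contradiction (sym e) (Fin.punchInᵢ≢i a k)
  ... | no  _ = trans (Fin.punchOut-cong a refl) (Fin.punchOut-punchIn a)

  merge-kernel : ∀ k l → merge k ≡ merge l → k ≡ l ⊎ (k ≡ a × l ≡ b) ⊎ (k ≡ b × l ≡ a)
  merge-kernel k l e with a ≟ k | a ≟ l
  ... | yes a≡k | yes a≡l = inj₁ (trans (sym a≡k) a≡l)
  ... | yes a≡k | no  a≢l = inj₂ (inj₁ (sym a≡k , sym (Fin.punchOut-injective a≢b a≢l e)))
  ... | no  a≢k | yes a≡l = inj₂ (inj₂ (Fin.punchOut-injective a≢k a≢b e , sym a≡l))
  ... | no  a≢k | no  a≢l = inj₁ (Fin.punchOut-injective a≢k a≢l e)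

-- The last hypothesis says that T lies in the equivalence generated by S and (i , j).
Classes-merge : {S T : Rel (Fin n) 0ℓ} {i j : Fin n} → Classes S c →
  ¬ S i j → S ⇒ T → T i j → IsEquivalence T →
  (∀ {d} (h : Fin n → Fin d) → S ⇒ (λ x y → h x ≡ h y) → h i ≡ h j → T ⇒ (λ x y → h x ≡ h y)) →
  ∃ λ d → Classes T d × c ≡ suc d
Classes-merge {c = zero} {i = i} cs = contradiction (Classes.index cs i) λ ()
Classes-merge {c = suc d} {T = T} {i} {j} cs i≁j S⇒T Tij eqT T-generated = d , record
  { index = merge ∘ C.index
  ; rep = C.rep ∘ punchIn (C.index i)
  ; index-rep = λ k → trans (cong merge (C.index-rep _)) (merge-punchIn k)
  -- The merged index is constant along `S` and agrees at `i` and `j`, so the generation hypothesis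
  -- makes it constant along `T`.
  ; sound = T-generated (merge ∘ C.index) (cong merge ∘ C.sound) merge-a≡merge-b
  ; complete = λ {x} {y} → joined x y ∘ merge-kernel _ _
  } , refl
  where
  module C = Classes cs
  open Merge (i≁j ∘ C.complete)
  open IsEquivalence eqT using () renaming (sym to symT; trans to transT)
  link : ∀ {x y} → C.index x ≡ C.index y → T x y
  link = S⇒T ∘ C.complete
  joined : ∀ x y → C.index x ≡ C.index y ⊎ (C.index x ≡ C.index i × C.index y ≡ C.index j)
                                         ⊎ (C.index x ≡ C.index j × C.index y ≡ C.index i) → T x y
  joined x y (inj₁ e)              = link e
  joined x y (inj₂ (inj₁ (p , q))) = transT (link p) (transT Tij (link (sym q)))
  joined x y (inj₂ (inj₂ (p , q))) = transT (link p) (transT (symT Tij) (link (sym q)))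

-- Orbits of permutations

Steps : Permutation′ n → Rel (Fin n) 0ℓ
Steps π x y = π ⟨$⟩ʳ x ≡ y

-- Only forward steps are allowed; that this relation is symmetric is a consequence of finiteness.
Orbit : Permutation′ n → Rel (Fin n) 0ℓ
Orbit π = Star (Steps π)

module _ (π : Permutation′ n) where

  private
    power : Fin n → ℕ → Fin n
    power x = fold x (π ⟨$⟩ʳ_)

    Orbit-power : ∀ x m → Orbit π x (power x m)
    Orbit-power x zero    = ε
    Orbit-power x (suc m) = Orbit-power x m ◅◅ (refl ◅ ε)

    power-suc : ∀ x m → power (π ⟨$⟩ʳ x) m ≡ power x (suc m)
    power-suc x zero    = refl
    power-suc x (suc m) = cong (π ⟨$⟩ʳ_) (power-suc x m)

    power-cancel : ∀ x k m → power x k ≡ power x (k + m) → x ≡ power x m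
    power-cancel x zero    m e = e
    power-cancel x (suc k) m e = power-cancel x k m
      (trans (sym (Perm.inverseˡ π)) (trans (cong (π ⟨$⟩ˡ_) e) (Perm.inverseˡ π)))

    -- By pigeonhole two of `x` and its first `n` iterates coincide. Cancelling the smaller exponent
    -- shows that `suc m` steps lead from `x` back to `x`, hence `m` steps lead there from its
    -- image.
    Orbit-return : ∀ x → Orbit π (π ⟨$⟩ʳ x) x
    Orbit-return x with Fin.pigeonhole (ℕ.n<1+n n) (power x ∘ toℕ)
    ... | i , j , i<j , e with ℕ.m≤n⇒∃[o]m+o≡n i<j
    ... | m , m+i≡j = subst (Orbit π (π ⟨$⟩ʳ x))
      (trans (power-suc x m) (sym (power-cancel x (toℕ i) (suc m)
        (trans e (cong (power x) (trans (sym m+i≡j) (sym (ℕ.+-suc _ m))))))))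
      (Orbit-power (π ⟨$⟩ʳ x) m)

  Orbit-sym : ∀ {x y} → Orbit π x y → Orbit π y x
  Orbit-sym ε           = ε
  Orbit-sym (refl ◅ xs) = Orbit-sym xs ◅◅ Orbit-return _

  Orbit-isEquivalence : IsEquivalence (Orbit π)
  Orbit-isEquivalence = record { refl = ε ; sym = Orbit-sym ; trans = _◅◅_ }

  opaque

    orbits : ℕ
    orbits = proj₁ (classes (Reachability.star? λ x y → π ⟨$⟩ʳ x ≟ y) Orbit-isEquivalence)

    orbitClasses : Classes (Orbit π) orbits
    orbitClasses = proj₂ (classes (Reachability.star? λ x y → π ⟨$⟩ʳ x ≟ y) Orbit-isEquivalence)

-- An equivalence relation that contains the single steps contains the orbit relation, so between
-- the two there is only the orbit relation itself. This is how orbit counts are computed below.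
Classes-orbits : (π : Permutation′ n) {S : Rel (Fin n) 0ℓ} →
  Steps π ⇒ S → S ⇒ Orbit π → IsEquivalence S → Classes S c → c ≡ orbits π
Classes-orbits π π⇒S S⇒π eq cs =
  Classes-unique S⇒π (Star.fold _ (trans~ ∘ π⇒S) refl~) cs (orbitClasses π)
  where open IsEquivalence eq using () renaming (refl to refl~; trans to trans~)

orbits-cong : (π ρ : Permutation′ n) → π Perm.≈ ρ → orbits π ≡ orbits ρ
orbits-cong π ρ π≈ρ = Classes-orbits ρ
  (λ e → trans (π≈ρ _) e ◅ ε) (Star.map (trans (sym (π≈ρ _))))
  (Orbit-isEquivalence π) (orbitClasses π)

orbits-id : orbits (Perm.id {n}) ≡ n
orbits-id = sym (Classes-orbits Perm.id (λ e → e) (λ { refl → ε }) isEquivalence record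
  { index = λ x → x ; rep = λ x → x ; index-rep = λ _ → refl ; sound = λ e → e ; complete = λ e → e })

-- Multiplication by a transposition

module _ (i j : Fin n) where

  transpose-fst : transpose i j ⟨$⟩ʳ i ≡ j
  transpose-fst rewrite dec-true (i ≟ i) refl = refl

  transpose-snd : transpose i j ⟨$⟩ʳ j ≡ i
  transpose-snd with j ≟ i
  ... | yes j≡i = j≡i
  ... | no  _ rewrite dec-true (j ≟ j) refl = refl

  transpose-other : ∀ {x} → x ≢ i → x ≢ j → transpose i j ⟨$⟩ʳ x ≡ x
  transpose-other {x} x≢i x≢j rewrite dec-false (x ≟ i) x≢i | dec-false (x ≟ j) x≢j = refl

transpose-self : (i : Fin n) → transpose i i Perm.≈ Perm.id
transpose-self i x with x ≟ i
... | yes refl = refl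
... | no  x≢i rewrite dec-false (x ≟ i) x≢i = refl

-- The last index is the first point of `i`, `j` met on the forward walk from `x`. Before that point
-- the walk avoids both, so `π` and `transpose i j ∘ₚ π` agree along it.
data FirstHit (π : Permutation′ n) (i j : Fin n) : Rel (Fin n) 0ℓ where
  here : ∀ {x} → x ≡ i ⊎ x ≡ j → FirstHit π i j x x
  next : ∀ {x z} → x ≢ i → x ≢ j → FirstHit π i j (π ⟨$⟩ʳ x) z → FirstHit π i j x z

module _ (π : Permutation′ n) (i j : Fin n) where

  firstHit : ∀ {x} → Orbit π x i → FirstHit π i j x i ⊎ FirstHit π i j x j
  firstHit ε = inj₁ (here (inj₁ refl))
  firstHit {x} (refl ◅ xs) with x ≟ i | x ≟ j
  ... | yes refl | _        = inj₁ (here (inj₁ refl))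
  ... | no _     | yes refl = inj₂ (here (inj₂ refl))
  ... | no x≢i   | no x≢j with firstHit xs
  ...   | inj₁ p = inj₁ (next x≢i x≢j p)
  ...   | inj₂ p = inj₂ (next x≢i x≢j p)

  FirstHit⇒Orbit-transpose : FirstHit π i j ⇒ Orbit (transpose i j ∘ₚ π)
  FirstHit⇒Orbit-transpose (here _)           = ε
  FirstHit⇒Orbit-transpose (next x≢i x≢j p) =
    cong (π ⟨$⟩ʳ_) (transpose-other i j x≢i x≢j) ◅ FirstHit⇒Orbit-transpose p

  -- The walk is the same for both permutations. Exchanging `i` and `j` in the conclusion prepares
  -- for the merging argument with the two points in opposite roles.
  FirstHit-transpose : FirstHit π i j ⇒ FirstHit (transpose i j ∘ₚ π) j i
  FirstHit-transpose (here (inj₁ e)) = here (inj₂ e)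
  FirstHit-transpose (here (inj₂ e)) = here (inj₁ e)
  FirstHit-transpose {x} {z} (next x≢i x≢j p) = next x≢j x≢i
    (subst (λ y → FirstHit (transpose i j ∘ₚ π) j i y z)
      (sym (cong (π ⟨$⟩ʳ_) (transpose-other i j x≢i x≢j))) (FirstHit-transpose p))

  module _ (i≢j : i ≢ j) (hit : FirstHit π i j (π ⟨$⟩ʳ i) i) where

    -- The set of points whose first hit is i is closed under π and misses j.
    firstHit-separates : ¬ Orbit π i j
    firstHit-separates p = misses-j (closed p (here (inj₁ refl)))
      where
      closed : ∀ {x y} → Orbit π x y → FirstHit π i j x i → FirstHit π i j y i
      closed ε           h            = h
      closed (refl ◅ xs) (here _)     = closed xs hit
      closed (refl ◅ xs) (next _ _ h) = closed xs h
      misses-j : ¬ FirstHit π i j j i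
      misses-j (here _)       = i≢j refl
      misses-j (next _ j≢j _) = j≢j refl

    -- Here `i` and `j` lie on different cycles of `π`, and the transposition splices these two
    -- cycles into one, leaving the others alone.
    orbits-merge : orbits π ≡ suc (orbits (transpose i j ∘ₚ π))
    orbits-merge with Classes-merge {T = Orbit π′} (orbitClasses π) firstHit-separates
                        π⇒π′ (Orbit-sym π′ j~i) (Orbit-isEquivalence π′) generated
      where
      π′ : Permutation′ n
      π′ = transpose i j ∘ₚ π
      j~i : Orbit π′ j i
      -- `π′` sends `j` to the `π`-image of `i`, from where the walk of `π` down to `i` is also a
      -- walk of `π′`.
      j~i = cong (π ⟨$⟩ʳ_) (transpose-snd i j) ◅ FirstHit⇒Orbit-transpose hit
      step : ∀ x → Orbit π′ x (π ⟨$⟩ʳ x)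
      step x with x ≟ i | x ≟ j
      -- The `π`-step out of `i` is the `π′`-step out of `j`, and conversely; the link between `i`
      -- and `j` supplies the detour.
      ... | yes refl | _        = Orbit-sym π′ j~i ◅◅ (cong (π ⟨$⟩ʳ_) (transpose-snd i j) ◅ ε)
      ... | no _     | yes refl = j~i ◅◅ (cong (π ⟨$⟩ʳ_) (transpose-fst i j) ◅ ε)
      ... | no x≢i   | no x≢j   = cong (π ⟨$⟩ʳ_) (transpose-other i j x≢i x≢j) ◅ ε
      π⇒π′ : Orbit π ⇒ Orbit π′
      π⇒π′ ε           = ε
      π⇒π′ (refl ◅ xs) = step _ ◅◅ π⇒π′ xs
      generated : ∀ {d} (h : Fin n → Fin d) → Orbit π ⇒ (λ x y → h x ≡ h y) → h i ≡ h j →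
                  Orbit π′ ⇒ (λ x y → h x ≡ h y)
      generated h resp hi≡hj ε           = refl
      generated h resp hi≡hj (_◅_ {i = x} refl xs) = trans hx≡hπ′x (generated h resp hi≡hj xs)
        where
        hx≡hπ′x : h x ≡ h (π′ ⟨$⟩ʳ x)
        hx≡hπ′x with x ≟ i
        ... | yes refl = trans hi≡hj (resp (refl ◅ ε))
        ... | no x≢i with x ≟ j
        ...   | yes refl = trans (sym hi≡hj) (resp (refl ◅ ε))
        ...   | no _     = resp (refl ◅ ε)
    ... | d , cs , e = trans e (cong suc (Classes-unique (λ p → p) (λ p → p) cs
                         (orbitClasses (transpose i j ∘ₚ π))))

-- The first point of {i , j} on the forward walk from π i decides which of π and
-- transpose i j ∘ₚ π has i and j in different orbits.
parity-orbits-transpose : ∀ {i j} (π : Permutation′ n) → i ≢ j →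
  parity (orbits (transpose i j ∘ₚ π)) ≡ parity (orbits π) ⁻¹
parity-orbits-transpose {i = i} {j} π i≢j with firstHit π i j (Orbit-sym π {i} (refl ◅ ε))
... | inj₁ hit rewrite orbits-merge π i j i≢j hit = sym (ℙ.suc-homo-⁻¹ (orbits (transpose i j ∘ₚ π)))
-- Now the walk of `π′` from the image of `j` returns to `j` before meeting `i`, so merging applies
-- to `π′` with `i` and `j` exchanged, and a second transposition restores `π`.
... | inj₂ hit = begin
  parity (orbits π′)
    ≡⟨ cong parity (orbits-merge π′ j i (i≢j ∘ sym) hit′) ⟩
  parity (suc (orbits (transpose j i ∘ₚ π′)))
    ≡⟨ ℙ.⁻¹-selfInverse (ℙ.suc-homo-⁻¹ (orbits (transpose j i ∘ₚ π′))) ⟨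
  parity (orbits (transpose j i ∘ₚ π′)) ⁻¹
    ≡⟨ cong (λ c → parity c ⁻¹) (orbits-cong _ _ undo) ⟩
  parity (orbits π) ⁻¹ ∎
  where
  open ≡-Reasoning
  π′ = transpose i j ∘ₚ π
  hit′ : FirstHit π′ j i (π′ ⟨$⟩ʳ j) j
  hit′ = subst (λ y → FirstHit π′ j i y j) (sym (cong (π ⟨$⟩ʳ_) (transpose-snd i j)))
           (FirstHit-transpose π i j hit)
  undo : (transpose j i ∘ₚ π′) Perm.≈ π
  -- By definition `transpose j i` is the inverse of `transpose i j`.
  undo x = cong (π ⟨$⟩ʳ_) (Perm.inverseʳ (transpose i j))

-- The parity of `n` plus the number of orbits is the sign of a permutation, and this is its
-- multiplicativity. Each transposition split off `π` flips both sides; what remains is the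
-- identity, with `n` orbits.
parity-orbits-∘ : (π ρ : Permutation′ n) →
  parity (orbits (π ∘ₚ ρ)) ℙ.+ parity n ≡ parity (orbits π) ℙ.+ parity (orbits ρ)
parity-orbits-∘ {n} π ρ = subst (λ c → parity c ℙ.+ parity n ≡ parity (orbits π) ℙ.+ parity (orbits ρ))
  (orbits-cong (eval ts ∘ₚ ρ) (π ∘ₚ ρ) λ x → cong (ρ ⟨$⟩ʳ_) (eval-decompose π x))
  (trans (go ts) (cong (λ p → parity p ℙ.+ _) (orbits-cong (eval ts) π (eval-decompose π))))
  where
  ts = decompose π
  go : ∀ ts → parity (orbits (eval ts ∘ₚ ρ)) ℙ.+ parity n ≡ parity (orbits (eval ts)) ℙ.+ parity (orbits ρ)
  go [] = trans (ℙ.+-comm _ (parity n)) (cong₂ ℙ._+_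
    (cong parity (sym orbits-id)) (cong parity (orbits-cong ρ (Perm.id ∘ₚ ρ) λ _ → refl)))
  go ((i , j) ∷ ts) with i ≟ j
  -- A pair in the list may have equal entries; it then acts as the identity and flips neither side.
  ... | yes refl = begin
    parity (orbits (eval ((i , i) ∷ ts) ∘ₚ ρ)) ℙ.+ parity n
      ≡⟨ cong (λ c → parity c ℙ.+ _) (orbits-cong _ _ λ x → cong ((eval ts ∘ₚ ρ) ⟨$⟩ʳ_) (transpose-self i x)) ⟩
    parity (orbits (eval ts ∘ₚ ρ)) ℙ.+ parity n
      ≡⟨ go ts ⟩
    parity (orbits (eval ts)) ℙ.+ parity (orbits ρ)
      ≡⟨ cong (λ c → parity c ℙ.+ _) (orbits-cong _ _ λ x → cong (eval ts ⟨$⟩ʳ_) (transpose-self i x)) ⟨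
    parity (orbits (eval ((i , i) ∷ ts))) ℙ.+ parity (orbits ρ) ∎
    where open ≡-Reasoning
  ... | no i≢j = begin
    parity (orbits (eval ((i , j) ∷ ts) ∘ₚ ρ)) ℙ.+ parity n
      ≡⟨ cong (λ c → parity c ℙ.+ _) (orbits-cong _ _ λ _ → refl) ⟩
    parity (orbits (transpose i j ∘ₚ (eval ts ∘ₚ ρ))) ℙ.+ parity n
      ≡⟨ cong (ℙ._+ parity n) (parity-orbits-transpose (eval ts ∘ₚ ρ) i≢j) ⟩
    parity (orbits (eval ts ∘ₚ ρ)) ⁻¹ ℙ.+ parity n
      -- `1ℙ ℙ.+ p` computes to `p ⁻¹`, so associativity moves the flip outside the sum.
      ≡⟨ ℙ.+-assoc 1ℙ (parity (orbits (eval ts ∘ₚ ρ))) (parity n) ⟩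
    (parity (orbits (eval ts ∘ₚ ρ)) ℙ.+ parity n) ⁻¹
      ≡⟨ cong _⁻¹ (go ts) ⟩
    (parity (orbits (eval ts)) ℙ.+ parity (orbits ρ)) ⁻¹
      ≡⟨ ℙ.+-assoc 1ℙ (parity (orbits (eval ts))) (parity (orbits ρ)) ⟨
    parity (orbits (eval ts)) ⁻¹ ℙ.+ parity (orbits ρ)
      ≡⟨ cong (ℙ._+ parity (orbits ρ)) (parity-orbits-transpose (eval ts) i≢j) ⟨
    parity (orbits (eval ((i , j) ∷ ts))) ℙ.+ parity (orbits ρ) ∎
    where open ≡-Reasoning

-- Subsets and degrees

module _ {P : Fin n → Set} (P? : ∀ i → Dec (P i)) where

  ∈-tabulate⁺ : ∀ {i} → P i → i ∈ tabulate (does ∘ P?)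
  ∈-tabulate⁺ {i} p = lookup⇒[]= i _ (trans (lookup∘tabulate _ i) (dec-true (P? i) p))

  ∈-tabulate⁻ : ∀ {i} → i ∈ tabulate (does ∘ P?) → P i
  ∈-tabulate⁻ {i} i∈ with P? i in eq
  ... | yes p = p
  ... | no  _ = contradiction
    (trans (sym ([]=⇒lookup i∈)) (trans (lookup∘tabulate _ i) (cong does eq))) λ ()

∣p∪q∣≡∣p∣+∣q∣ : (p q : Subset n) → Empty (p ∩ q) → ∣ p ∪ q ∣ ≡ ∣ p ∣ + ∣ q ∣
∣p∪q∣≡∣p∣+∣q∣ []            []            _ = refl
∣p∪q∣≡∣p∣+∣q∣ (outside ∷ p) (outside ∷ q) e = ∣p∪q∣≡∣p∣+∣q∣ p q (Subset.drop-∷-Empty e)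
∣p∪q∣≡∣p∣+∣q∣ (inside ∷ p)  (outside ∷ q) e = cong suc (∣p∪q∣≡∣p∣+∣q∣ p q (Subset.drop-∷-Empty e))
∣p∪q∣≡∣p∣+∣q∣ (outside ∷ p) (inside ∷ q)  e =
  trans (cong suc (∣p∪q∣≡∣p∣+∣q∣ p q (Subset.drop-∷-Empty e))) (sym (ℕ.+-suc _ _))
∣p∪q∣≡∣p∣+∣q∣ (inside ∷ p)  (inside ∷ q)  e = contradiction (zero , hereᵛ) e

∈-subsets : (p : Subset n) → p ∈ˡ subsets n
∈-subsets []            = here refl
∈-subsets (outside ∷ p) = ∈-++⁺ˡ (∈-map⁺ (outside ∷_) (∈-subsets p))
∈-subsets (inside ∷ p)  = ∈-++⁺ʳ (map (outside ∷_) (subsets _)) (∈-map⁺ (inside ∷_) (∈-subsets p))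

subsets-unique : ∀ n → Unique (subsets n)
subsets-unique zero    = [] ∷ []
subsets-unique (suc n) = Unique.++⁺
  (Unique.map⁺ ∷-injectiveʳ (subsets-unique n))
  (Unique.map⁺ ∷-injectiveʳ (subsets-unique n))
  λ (p∈ , q∈) → disjoint (∈-map⁻ (outside ∷_) p∈) (∈-map⁻ (inside ∷_) q∈)
  where
  disjoint : ∀ {p} → ∃ (λ q → q ∈ˡ subsets n × p ≡ outside ∷ q) →
             ¬ ∃ (λ q → q ∈ˡ subsets n × p ≡ inside ∷ q)
  disjoint (_ , _ , refl) (_ , _ , ())

lookup-injective : {A : Set} {xs : List A} → Unique xs → ∀ i j → lookup xs i ≡ lookup xs j → i ≡ j
lookup-injective (x∉ ∷ u) zero    zero    e = refl
lookup-injective {xs = _ ∷ xs} (x∉ ∷ u) zero (suc j) e =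
  contradiction e (All.lookup x∉ (∈-lookup {xs = xs} j))
lookup-injective {xs = _ ∷ xs} (x∉ ∷ u) (suc i) zero e =
  contradiction (sym e) (All.lookup x∉ (∈-lookup {xs = xs} i))
lookup-injective (x∉ ∷ u) (suc i) (suc j) e = cong suc (lookup-injective u i j e)

module _ (G : Graph) where
  open Graph G

  private
    tails heads : Vertex G → EdgeSet G
    tails x = tabulate (λ e → does (proj₁ (ends e) ≟ x))
    heads x = tabulate (λ e → does (proj₂ (ends e) ≟ x))

    ∩-mono-⊆ : {S T R : EdgeSet G} → (∀ {e} → e ∈ R → e ∈ S → e ∈ T) → S ∩ R ⊆ T ∩ R
    ∩-mono-⊆ {S} {T} {R} h e∈ = let e∈S , e∈R = Subset.x∈p∩q⁻ S R e∈ in Subset.x∈p∩q⁺ (h e∈R e∈S , e∈R)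

    ∣∩∣-mono-< : {S T R : EdgeSet G} → (∀ {e} → e ∈ R → e ∈ S → e ∈ T) →
                 ∀ {e} → e ∈ R → e ∈ T → e ∉ S → ∣ S ∩ R ∣ < ∣ T ∩ R ∣
    ∣∩∣-mono-< {S} {T} {R} h e∈R e∈T e∉S = Subset.p⊂q⇒∣p∣<∣q∣
      (∩-mono-⊆ {S} {T} {R} h , _ , Subset.x∈p∩q⁺ (e∈T , e∈R) , e∉S ∘ proj₁ ∘ Subset.x∈p∩q⁻ S R)

  module _ {S T : EdgeSet G} {x : Vertex G} (S⊆T : ∀ {e} → Incident G e x → e ∈ S → e ∈ T) where

    private
      viaTail : ∀ {e} → e ∈ tails x → e ∈ S → e ∈ T
      viaTail = S⊆T ∘ inj₁ ∘ ∈-tabulate⁻ (λ e → proj₁ (ends e) ≟ x)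

      viaHead : ∀ {e} → e ∈ heads x → e ∈ S → e ∈ T
      viaHead = S⊆T ∘ inj₂ ∘ ∈-tabulate⁻ (λ e → proj₂ (ends e) ≟ x)

      tails-≤ : ∣ S ∩ tails x ∣ ≤ ∣ T ∩ tails x ∣
      tails-≤ = Subset.p⊆q⇒∣p∣≤∣q∣ (∩-mono-⊆ {S} {T} viaTail)

      heads-≤ : ∣ S ∩ heads x ∣ ≤ ∣ T ∩ heads x ∣
      heads-≤ = Subset.p⊆q⇒∣p∣≤∣q∣ (∩-mono-⊆ {S} {T} viaHead)

    -- The inclusion is assumed only for edges at `x`, so that a component or a cycle can be
    -- compared with the whole edge set at one of its vertices.
    degree-mono-≤ : degree G S x ≤ degree G T x
    degree-mono-≤ = ℕ.+-mono-≤ tails-≤ heads-≤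

    degree-mono-< : ∀ {e} → Incident G e x → e ∈ T → e ∉ S → degree G S x < degree G T x
    degree-mono-< (inj₁ p) e∈T e∉S = ℕ.+-mono-<-≤
      (∣∩∣-mono-< {S} {T} viaTail (∈-tabulate⁺ (λ e → proj₁ (ends e) ≟ x) p) e∈T e∉S) heads-≤
    degree-mono-< (inj₂ p) e∈T e∉S = ℕ.+-mono-≤-<
      tails-≤ (∣∩∣-mono-< {S} {T} viaHead (∈-tabulate⁺ (λ e → proj₂ (ends e) ≟ x) p) e∈T e∉S)

  degree-∪ : (S T : EdgeSet G) → Empty (S ∩ T) → ∀ x → degree G (S ∪ T) x ≡ degree G S x + degree G T x
  degree-∪ S T S∩T≡∅ x = begin
    ∣ (S ∪ T) ∩ tails x ∣ + ∣ (S ∪ T) ∩ heads x ∣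
      ≡⟨ cong₂ _+_ (split (tails x)) (split (heads x)) ⟩
    (∣ S ∩ tails x ∣ + ∣ T ∩ tails x ∣) + (∣ S ∩ heads x ∣ + ∣ T ∩ heads x ∣)
      ≡⟨ interchange ℕ.+-commutativeSemigroup ∣ S ∩ tails x ∣ _ _ _ ⟩
    degree G S x + degree G T x ∎
    where
    open ≡-Reasoning
    split : ∀ R → ∣ (S ∪ T) ∩ R ∣ ≡ ∣ S ∩ R ∣ + ∣ T ∩ R ∣
    split R = trans (cong ∣_∣ (Subset.∩-distribʳ-∪ R S T)) (∣p∪q∣≡∣p∣+∣q∣ (S ∩ R) (T ∩ R)
      λ (e , e∈) → let e∈SR , e∈TR = Subset.x∈p∩q⁻ (S ∩ R) (T ∩ R) e∈ in
        S∩T≡∅ (e , Subset.x∈p∩q⁺ (proj₁ (Subset.x∈p∩q⁻ S R e∈SR) , proj₁ (Subset.x∈p∩q⁻ T R e∈TR))))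

  degree-⊥ : ∀ x → degree G ⊥ x ≡ 0
  degree-⊥ x = cong₂ _+_ (empty (tails x)) (empty (heads x))
    where
    empty : ∀ R → ∣ ⊥ ∩ R ∣ ≡ 0
    empty R = trans (cong ∣_∣ (Subset.∩-zeroˡ R)) (Subset.∣⊥∣≡0 ∣E∣)

  degree>0⇒Covers : (S : EdgeSet G) {x : Vertex G} → 0 < degree G S x → Covers G S x
  degree>0⇒Covers S {x} 0<d with covers? G S x
  ... | yes cov = cov
  ... | no ¬cov = contradiction
    (ℕ.<-≤-trans 0<d (degree-mono-≤ {S} {⊥} λ {e} inc e∈S → contradiction (e , e∈S , inc) ¬cov))
    (ℕ.n≮0 ∘ subst (0 <_) (degree-⊥ x))

  -- Two distinct edges would make the degree at `x` increase strictly from `⊥` to `⁅ e ⁆` and again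
  -- to `S`, hence reach 2.
  degree≤1⇒unique : {S : EdgeSet G} {x : Vertex G} → degree G S x ≤ 1 →
    ∀ {e e′} → e ∈ S → e′ ∈ S → Incident G e x → Incident G e′ x → e ≡ e′
  degree≤1⇒unique {S} {x} d≤1 {e} {e′} e∈S e′∈S inc inc′ with e ≟ e′
  ... | yes e≡e′ = e≡e′
  ... | no  e≢e′ = contradiction d≤1 (ℕ.<⇒≱ (ℕ.≤-<-trans
    (ℕ.≤-<-trans z≤n
      (degree-mono-< {⊥} (λ _ e∈⊥ → contradiction e∈⊥ Subset.∉⊥) inc (Subset.x∈⁅x⁆ e) Subset.∉⊥))
    (degree-mono-< {⁅ e ⁆} {S}
      (λ _ e″∈ → subst (_∈ S) (sym (Subset.x∈⁅y⁆⇒x≡y e e″∈)) e∈S)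
      inc′ e′∈S (e≢e′ ∘ sym ∘ Subset.x∈⁅y⁆⇒x≡y e))))

  Adjacent-sym : {S : EdgeSet G} → ∀ {x y} → Adjacent G S x y → Adjacent G S y x
  Adjacent-sym (e , e∈S , joins) = e , e∈S , swap joins

  Connected-isEquivalence : (S : EdgeSet G) → IsEquivalence (Star (Adjacent G S))
  Connected-isEquivalence S = record
    { refl = ε ; sym = Star.reverse Adjacent-sym ; trans = _◅◅_ }

  -- Cycles of a 2-regular edge set

  module _ {X : EdgeSet G} (2-regular : ∀ x → degree G X x ≡ 2) where

    private
      tail : Edge G → Vertex G
      tail e = proj₁ (ends e)

      inComponent? : ∀ x e → Dec (e ∈ X × Star (Adjacent G X) x (tail e))
      inComponent? x e = (e Subset.∈? X) ×-dec Reachability.star? (adjacent? G X) x (tail e)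

      -- Testing the tail is enough: the two ends of an edge of `X` are reachable from the same
      -- vertices.
      component : Vertex G → EdgeSet G
      component x = tabulate (does ∘ inComponent? x)

      component⁻ : ∀ {x e} → e ∈ component x → e ∈ X × Star (Adjacent G X) x (tail e)
      component⁻ {x} = ∈-tabulate⁻ (inComponent? x)

      component⊆X : ∀ {x} → component x ⊆ X
      component⊆X = proj₁ ∘ component⁻

      incident⇒connected : ∀ {e x} → e ∈ X → Incident G e x → Star (Adjacent G X) x (tail e)
      incident⇒connected e∈X (inj₁ refl) = ε
      incident⇒connected e∈X (inj₂ refl) = (_ , e∈X , inj₂ (refl , refl)) ◅ ε

      component⁺ : ∀ {x y e} → Star (Adjacent G X) x y → e ∈ X → Incident G e y → e ∈ component x
      component⁺ {x} x⇝y e∈X inc =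
        ∈-tabulate⁺ (inComponent? x) (e∈X , x⇝y ◅◅ incident⇒connected e∈X inc)

      component-connected : ∀ {x y} → Covers G (component x) y → Star (Adjacent G X) x y
      component-connected {x} (e , e∈ , inc) = let e∈X , x⇝e = component⁻ e∈ in
        x⇝e ◅◅ Star.reverse Adjacent-sym (incident⇒connected e∈X inc)

      covered : ∀ x → Covers G X x
      covered x = degree>0⇒Covers X (subst (0 <_) (sym (2-regular x)) (s≤s z≤n))

      stays : ∀ {x y z} → Star (Adjacent G X) x y → Star (Adjacent G X) y z →
              Star (Adjacent G (component x)) y z
      stays x⇝y ε = ε
      stays {x} x⇝y (a@(e , e∈X , joins) ◅ y⇝z) =
        (e , component⁺ x⇝y e∈X (⊎.map proj₁ proj₂ joins) , joins) ◅ stays (x⇝y ◅◅ (a ◅ ε)) y⇝z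

      component-cycle : ∀ x → Cycle G (component x)
      component-cycle x = nonempty , regular , λ y z cy cz → stays (component-connected cy)
        (Star.reverse Adjacent-sym (component-connected cy) ◅◅ component-connected cz)
        where
        nonempty = let e , e∈X , inc = covered x in e , component⁺ ε e∈X inc
        regular : ∀ y → Covers G (component x) y → degree G (component x) y ≡ 2
        regular y cy = trans (ℕ.≤-antisym
          (degree-mono-≤ {component x} {X} λ _ → component⊆X)
          (degree-mono-≤ λ inc e∈X → component⁺ (component-connected cy) e∈X inc)) (2-regular y)

      -- At a vertex that it covers, a cycle already has the full degree 2 of `X`, so it contains
      -- every edge of `X` there. Walks in `X` therefore never leave the cycle.
      cycle≡component : ∀ {S e} → Cycle G S → S ⊆ X → e ∈ S → component (tail e) ≡ S
      cycle≡component {S} {e₀} (_ , regular , connected) S⊆X e₀∈S = Subset.⊆-antisym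
        (λ e∈ → let e∈X , x⇝e = component⁻ e∈ in
          saturated (reaches x⇝e (e₀ , e₀∈S , inj₁ refl)) (inj₁ refl) e∈X)
        (λ {e} e∈S → component⁺ (Star.map (λ (e , e∈S , j) → e , S⊆X e∈S , j)
          (connected _ _ (e₀ , e₀∈S , inj₁ refl) (e , e∈S , inj₁ refl))) (S⊆X e∈S) (inj₁ refl))
        where
        saturated : ∀ {y e} → Covers G S y → Incident G e y → e ∈ X → e ∈ S
        saturated {y} {e} cy inc e∈X with e Subset.∈? S
        ... | yes e∈S = e∈S
        ... | no  e∉S = contradiction (trans (regular y cy) (sym (2-regular y)))
          (ℕ.<⇒≢ (degree-mono-< {S} {X} (λ _ → S⊆X) inc e∈X e∉S))
        reaches : ∀ {y z} → Star (Adjacent G X) y z → Covers G S y → Covers G S z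
        reaches ε cy = cy
        reaches ((e , e∈X , joins) ◅ y⇝z) cy = reaches y⇝z
          (e , saturated cy (⊎.map proj₁ proj₂ joins) e∈X , swap (⊎.map proj₂ proj₁ joins))

      cycleIn? : ∀ S → Dec (Cycle G S × S ⊆ X)
      cycleIn? S = cycle? G S ×-dec (S Subset.⊆? X)

      component∈ : ∀ x → component x ∈ˡ cyclesIn G X
      component∈ x = ∈-filter⁺ cycleIn? (∈-subsets (component x)) (component-cycle x , component⊆X)

      index : Vertex G → Fin (length (cyclesIn G X))
      index x = Any.index (component∈ x)

      lookup-component : ∀ x → lookup (cyclesIn G X) (index x) ≡ component x
      lookup-component x = sym (lookup-index (component∈ x))

      cyclesIn-injective : ∀ {k l} → lookup (cyclesIn G X) k ≡ lookup (cyclesIn G X) l → k ≡ l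
      cyclesIn-injective = lookup-injective (Unique.filter⁺ cycleIn? (subsets-unique ∣E∣)) _ _

      cyclesIn-cycle : ∀ k → Cycle G (lookup (cyclesIn G X) k) × lookup (cyclesIn G X) k ⊆ X
      cyclesIn-cycle k = proj₂ (∈-filter⁻ cycleIn? {xs = subsets ∣E∣} (∈-lookup k))

      component-mono : ∀ {x y} → Star (Adjacent G X) x y → component y ⊆ component x
      component-mono x⇝y e∈ = let e∈X , y⇝e = component⁻ e∈ in component⁺ (x⇝y ◅◅ y⇝e) e∈X (inj₁ refl)

    -- Every component is a cycle and every cycle in `X` is a component, so positions in the
    -- duplicate-free list of cycles index the connectivity classes of vertices.
    cyclesIn-classes : Classes (Star (Adjacent G X)) (length (cyclesIn G X))
    cyclesIn-classes = record
      { index = index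
      ; rep = λ k → tail (proj₁ (proj₁ (proj₁ (cyclesIn-cycle k))))
      ; index-rep = λ k → let cyc@((e , e∈S) , _) , S⊆X = cyclesIn-cycle k in
          cyclesIn-injective (trans (lookup-component _) (cycle≡component cyc S⊆X e∈S))
      ; sound = λ {x} {y} x⇝y → cyclesIn-injective (trans (lookup-component x) (trans
          (Subset.⊆-antisym (component-mono (Star.reverse Adjacent-sym x⇝y)) (component-mono x⇝y))
          (sym (lookup-component y))))
      -- Equal positions mean equal components; an edge at `x` then lies in the component of `y` as
      -- well and links the two vertices.
      ; complete = λ {x} {y} eq → let e , e∈X , inc = covered x in
          incident⇒connected e∈X inc ◅◅ Star.reverse Adjacent-sym (proj₂ (component⁻
            (subst (e ∈_) (trans (sym (lookup-component x)) (trans (cong (lookup (cyclesIn G X)) eq)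
              (lookup-component y))) (component⁺ ε e∈X inc))))
      }

-- Matchings of bipartite graphs

module _ (G : Graph) where
  open Graph G

  Matching : Set
  Matching = ∃ (PerfectMatching G)

  module _ (M : Matching) where

    private
      A       = proj₁ M
      perfect = proj₂ M

      covered : ∀ x → Covers G A x
      covered x = degree>0⇒Covers G A (ℕ.≤-reflexive (sym (perfect x)))

      neighbour : ∀ x → ∃ (Adjacent G A x)
      neighbour x with covered x
      ... | e , e∈A , inj₁ p = _ , e , e∈A , inj₁ (p , refl)
      ... | e , e∈A , inj₂ p = _ , e , e∈A , inj₂ (refl , p)

    opaque

      mate : Vertex G → Vertex G
      mate x = proj₁ (neighbour x)

      mate-adjacent : ∀ x → Adjacent G A x (mate x)
      mate-adjacent x = proj₂ (neighbour x)

    Adjacent-unique : ∀ {x y z} → Adjacent G A x y → Adjacent G A x z → y ≡ z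
    Adjacent-unique (e , e∈A , j) (e′ , e′∈A , j′)
      with degree≤1⇒unique G (ℕ.≤-reflexive (perfect _)) e∈A e′∈A (⊎.map proj₁ proj₂ j) (⊎.map proj₁ proj₂ j′)
    ... | refl with j | j′
    ...   | inj₁ (_ , q) | inj₁ (_ , q′) = trans (sym q) q′
    -- With mixed orientations the edge is a loop at `x`, so all its ends coincide.
    ...   | inj₁ (p , q) | inj₂ (p′ , q′) = trans (sym q) (trans q′ (trans (sym p) p′))
    ...   | inj₂ (p , q) | inj₁ (p′ , q′) = trans (sym p) (trans p′ (trans (sym q) q′))
    ...   | inj₂ (p , _) | inj₂ (p′ , _) = trans (sym p) p′

    Adjacent⇒mate : ∀ {x y} → Adjacent G A x y → mate x ≡ y
    Adjacent⇒mate = Adjacent-unique (mate-adjacent _)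

    mate-involutive : ∀ x → mate (mate x) ≡ x
    mate-involutive x = Adjacent⇒mate (Adjacent-sym G (mate-adjacent x))

  -- Crossing permutations

  module _ (bipartition : Bipartite G) where

    private
      side      = proj₁ bipartition
      bipartite = proj₂ bipartition

    Adjacent-side : ∀ {S x y} → Adjacent G S x y → side y ≡ not (side x)
    Adjacent-side (e , _ , inj₁ (refl , refl)) = Bool.¬-not (bipartite e ∘ sym)
    Adjacent-side (e , _ , inj₂ (refl , refl)) = Bool.¬-not (bipartite e)

    side-mate : ∀ A x → side (mate A x) ≡ not (side x)
    side-mate A x = Adjacent-side (mate-adjacent A x)

    crossing : Matching → Matching → Vertex G → Vertex G
    crossing A B x = if side x then mate A x else mate B x

    crossing-true : ∀ {A B x} → side x ≡ true → crossing A B x ≡ mate A x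
    crossing-true eq rewrite eq = refl

    crossing-false : ∀ {A B x} → side x ≡ false → crossing A B x ≡ mate B x
    crossing-false eq rewrite eq = refl

    -- A move switches sides, so the crossing with the matchings exchanged goes back along the same
    -- edge.
    crossing-inverse : ∀ A B x → crossing A B (crossing B A x) ≡ x
    crossing-inverse A B x with side x in eq
    ... | true  = trans (crossing-false (trans (side-mate B x) (cong not eq))) (mate-involutive B x)
    ... | false = trans (crossing-true (trans (side-mate A x) (cong not eq))) (mate-involutive A x)

    crossingₚ : Matching → Matching → Permutation′ ∣V∣
    crossingₚ A B = Perm.permutation (crossing A B) (crossing B A)
      (crossing-inverse A B) (crossing-inverse B A)

    crossing-self : ∀ A x → crossing A A x ≡ mate A x
    crossing-self A x = Bool.if-eta (side x)

    -- Sides alternate, so one side of the bipartition moves along `A`, `C`, `C` and the other along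
    -- `B`, `B`, `A`; two consecutive moves along one matching cancel.
    crossing-crossing : ∀ A B C x → crossing C A (crossing B C (crossing A B x)) ≡ mate A x
    crossing-crossing A B C x = by-side (side x) refl
      where
      open ≡-Reasoning
      flipped : ∀ M {y b} → side y ≡ b → side (mate M y) ≡ not b
      flipped M {y} y∈ = trans (side-mate M y) (cong not y∈)
      by-side : ∀ b → side x ≡ b → crossing C A (crossing B C (crossing A B x)) ≡ mate A x
      by-side true x∈ = begin
        crossing C A (crossing B C (crossing A B x))
          ≡⟨ cong (crossing C A ∘ crossing B C) (crossing-true x∈) ⟩
        crossing C A (crossing B C (mate A x))
          ≡⟨ cong (crossing C A) (crossing-false (flipped A x∈)) ⟩
        crossing C A (mate C (mate A x))
          ≡⟨ crossing-true (flipped C (flipped A x∈)) ⟩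
        mate C (mate C (mate A x))
          ≡⟨ mate-involutive C _ ⟩
        mate A x ∎
      by-side false x∉ = begin
        crossing C A (crossing B C (crossing A B x))
          ≡⟨ cong (crossing C A ∘ crossing B C) (crossing-false x∉) ⟩
        crossing C A (crossing B C (mate B x))
          ≡⟨ cong (crossing C A) (crossing-true (flipped B x∉)) ⟩
        crossing C A (mate B (mate B x))
          ≡⟨ cong (crossing C A) (mate-involutive B x) ⟩
        crossing C A x
          ≡⟨ crossing-false x∉ ⟩
        mate A x ∎

    -- Disjointness makes the union 2-regular, so its cycles are its connectivity classes. Every
    -- edge of the union is a step of the permutation from exactly one of its ends.
    orbits-crossing : ((A , pA) (B , pB) : Matching) → Empty (A ∩ B) →
      orbits (crossingₚ (A , pA) (B , pB)) ≡ length (cyclesIn G (A ∪ B))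
    orbits-crossing 𝔸@(A , pA) 𝔹@(B , pB) A∩B≡∅ = sym (Classes-orbits π step orbit
      (Connected-isEquivalence G (A ∪ B))
      (cyclesIn-classes G λ x → trans (degree-∪ G A B A∩B≡∅ x) (cong₂ _+_ (pA x) (pB x))))
      where
      π = crossingₚ 𝔸 𝔹
      onA : ∀ {x y} → Adjacent G A x y → Adjacent G (A ∪ B) x y
      onA (e , e∈ , j) = e , Subset.x∈p∪q⁺ (inj₁ e∈) , j
      onB : ∀ {x y} → Adjacent G B x y → Adjacent G (A ∪ B) x y
      onB (e , e∈ , j) = e , Subset.x∈p∪q⁺ {p = A} (inj₂ e∈) , j
      step : ∀ {x y} → π ⟨$⟩ʳ x ≡ y → Star (Adjacent G (A ∪ B)) x y
      step {x} refl with side x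
      ... | true  = onA (mate-adjacent 𝔸 x) ◅ ε
      ... | false = onB (mate-adjacent 𝔹 x) ◅ ε
      A-orbit : ∀ {x y} → Adjacent G A x y → Orbit π x y
      A-orbit {x} {y} a with side x in eq
      ... | true  = trans (crossing-true eq) (Adjacent⇒mate 𝔸 a) ◅ ε
      -- From this side the `A`-edge is traversed backwards: it is the step out of its other end.
      ... | false = Orbit-sym π (trans (crossing-true (trans (Adjacent-side a) (cong not eq)))
                      (Adjacent⇒mate 𝔸 (Adjacent-sym G a)) ◅ ε)
      B-orbit : ∀ {x y} → Adjacent G B x y → Orbit π x y
      B-orbit {x} {y} a with side x in eq
      ... | false = trans (crossing-false eq) (Adjacent⇒mate 𝔹 a) ◅ ε
      ... | true  = Orbit-sym π (trans (crossing-false (trans (Adjacent-side a) (cong not eq)))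
                      (Adjacent⇒mate 𝔹 (Adjacent-sym G a)) ◅ ε)
      orbit : ∀ {x y} → Star (Adjacent G (A ∪ B)) x y → Orbit π x y
      orbit ε = ε
      orbit ((e , e∈ , j) ◅ xs) with Subset.x∈p∪q⁻ A B e∈
      ... | inj₁ e∈A = A-orbit (e , e∈A , j) ◅◅ orbit xs
      ... | inj₂ e∈B = B-orbit (e , e∈B , j) ◅◅ orbit xs

    -- The orbits are the pairs of mates, and mates lie on opposite sides, so a vertex is determined
    -- by its orbit and its side, and all combinations occur.
    orbits-crossing-self : ∀ A → ∣V∣ ≡ orbits (crossingₚ A A) * 2
    orbits-crossing-self A = Perm.↔⇒≡
      (↔-sym Fin.*↔× ↔-∘ ((↔-id _ ×-↔ ↔-sym Fin.2↔Bool) ↔-∘ mk↔ₛ′ to from to-from from-to))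
      where
      π = crossingₚ A A
      open Classes (orbitClasses π)
      orbit-pair : ∀ {x y} → Orbit π x y → x ≡ y ⊎ mate A x ≡ y
      orbit-pair ε = inj₁ refl
      orbit-pair {x} (refl ◅ xs) with orbit-pair xs
      ... | inj₁ e = inj₂ (trans (sym (crossing-self A x)) e)
      ... | inj₂ e = inj₁ (trans (sym (mate-involutive A x))
                       (trans (cong (mate A) (sym (crossing-self A x))) e))
      to : Vertex G → Fin (orbits π) × Bool
      to x = index x , side x
      from : Fin (orbits π) × Bool → Vertex G
      from (k , b) with side (rep k) Bool.≟ b
      ... | yes _ = rep k
      ... | no  _ = mate A (rep k)
      to-from : ∀ z → to (from z) ≡ z
      to-from (k , b) with side (rep k) Bool.≟ b
      ... | yes eq = cong₂ _,_ (index-rep k) eq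
      ... | no  ne = cong₂ _,_
        (trans (sym (sound (crossing-self A (rep k) ◅ ε))) (index-rep k))
        (trans (side-mate A (rep k)) (sym (Bool.¬-not (ne ∘ sym))))
      to-injective : ∀ {x y} → to x ≡ to y → x ≡ y
      to-injective {x} {y} eq with orbit-pair (complete (cong proj₁ eq))
      ... | inj₁ e = e
      ... | inj₂ refl = contradiction (trans (cong proj₂ eq) (side-mate A x)) (Bool.not-¬ refl)
      from-to : ∀ x → from (to x) ≡ x
      from-to x = to-injective (to-from (to x))

    parity-cycles : ((A , _) (B , _) (C , _) : Matching) →
      Empty (A ∩ B) → Empty (B ∩ C) → Empty (C ∩ A) → ∀ k → ∣V∣ ≡ 2 * k →
      parity (length (cyclesIn G (A ∪ B)) + (length (cyclesIn G (B ∪ C)) + length (cyclesIn G (C ∪ A))))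
        ≡ parity k
    parity-cycles A B C A∩B≡∅ B∩C≡∅ C∩A≡∅ k ∣V∣≡2k = begin
      parity (cycles A B + (cycles B C + cycles C A))
        ≡⟨ cong parity (cong₂ _+_ (orbits-crossing A B A∩B≡∅)
             (cong₂ _+_ (orbits-crossing B C B∩C≡∅) (orbits-crossing C A C∩A≡∅))) ⟨
      parity (orbits AB + (orbits BC + orbits CA))
        ≡⟨ ℙ.+-homo-+ (orbits AB) _ ⟩
      parity (orbits AB) ℙ.+ parity (orbits BC + orbits CA)
        ≡⟨ cong (parity (orbits AB) ℙ.+_) (ℙ.+-homo-+ (orbits BC) _) ⟩
      parity (orbits AB) ℙ.+ (parity (orbits BC) ℙ.+ parity (orbits CA))
        ≡⟨ cong (parity (orbits AB) ℙ.+_) (parity-∘ BC CA) ⟨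
      parity (orbits AB) ℙ.+ parity (orbits (BC ∘ₚ CA))
        ≡⟨ parity-∘ AB (BC ∘ₚ CA) ⟨
      parity (orbits (AB ∘ₚ (BC ∘ₚ CA)))
        ≡⟨ cong parity (orbits-cong (AB ∘ₚ (BC ∘ₚ CA)) (crossingₚ A A) λ x →
             trans (crossing-crossing A B C x) (sym (crossing-self A x))) ⟩
      parity (orbits (crossingₚ A A))
        ≡⟨ cong parity (ℕ.*-cancelʳ-≡ (orbits (crossingₚ A A)) k 2
             (trans (sym (orbits-crossing-self A)) (trans ∣V∣≡2k (ℕ.*-comm 2 k)))) ⟩
      parity k ∎
      where
      open ≡-Reasoning
      cycles : Matching → Matching → ℕ
      cycles A B = length (cyclesIn G (proj₁ A ∪ proj₁ B))
      AB = crossingₚ A B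
      BC = crossingₚ B C
      CA = crossingₚ C A
      -- The number of points is even, so the term `parity n` in `parity-orbits-∘` vanishes.
      parity-∣V∣ : parity ∣V∣ ≡ 0ℙ
      parity-∣V∣ = trans (cong parity ∣V∣≡2k) (ℙ.*-homo-* 2 k)
      parity-∘ : ∀ π ρ → parity (orbits (π ∘ₚ ρ)) ≡ parity (orbits π) ℙ.+ parity (orbits ρ)
      parity-∘ π ρ = begin
        parity (orbits (π ∘ₚ ρ))                   ≡⟨ ℙ.+-identityʳ _ ⟨
        parity (orbits (π ∘ₚ ρ)) ℙ.+ 0ℙ            ≡⟨ cong (parity (orbits (π ∘ₚ ρ)) ℙ.+_) parity-∣V∣ ⟨
        parity (orbits (π ∘ₚ ρ)) ℙ.+ parity ∣V∣    ≡⟨ parity-orbits-∘ π ρ ⟩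
        parity (orbits π) ℙ.+ parity (orbits ρ)    ∎

-- Handshaking, colorings and maps

sum-const : ∀ n d → sum {n} (λ _ → d) ≡ n * d
sum-const zero    d = refl
sum-const (suc n) d = cong (λ s → d + s) (sum-const n d)

sum-indicator : ∀ (i : Fin n) → sum (λ x → if does (i ≟ x) then 1 else 0) ≡ 1
sum-indicator {suc n} zero    = cong suc (trans (sum-const n 0) (ℕ.*-zeroʳ n))
sum-indicator {suc n} (suc i) = sum-indicator i

-- Double counting: each element of `S` lies in exactly one fibre of `f`.
sum-fibres : (f : Fin m → Fin n) (S : Subset m) →
             sum (λ x → ∣ S ∩ tabulate (λ e → does (f e ≟ x)) ∣) ≡ ∣ S ∣
sum-fibres {n = n} f []       = trans (sum-const n 0) (ℕ.*-zeroʳ n)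
sum-fibres f (outside ∷ S)    = sum-fibres (f ∘ suc) S
sum-fibres f (inside ∷ S)     = begin
  sum (λ x → ∣ (inside ∷ S) ∩ tabulate (λ e → does (f e ≟ x)) ∣)
    ≡⟨ sum-cong-≗ (λ x → count-∷ (does (f zero ≟ x)) (S ∩ tabulate (λ e → does (f (suc e) ≟ x)))) ⟩
  sum (λ x → (if does (f zero ≟ x) then 1 else 0) + ∣ S ∩ tabulate (λ e → does (f (suc e) ≟ x)) ∣)
    ≡⟨ ∑-distrib-+ (λ x → if does (f zero ≟ x) then 1 else 0) _ ⟩
  sum (λ x → if does (f zero ≟ x) then 1 else 0) + sum (λ x → ∣ S ∩ tabulate (λ e → does (f (suc e) ≟ x)) ∣)
    ≡⟨ cong₂ _+_ (sum-indicator (f zero)) (sum-fibres (f ∘ suc) S) ⟩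
  suc ∣ S ∣ ∎
  where
  open ≡-Reasoning
  count-∷ : ∀ s (p : Subset n) → ∣ s ∷ p ∣ ≡ (if s then 1 else 0) + ∣ p ∣
  count-∷ true  p = refl
  count-∷ false p = refl

parity≡0ℙ⇒2∣ : ∀ n → parity n ≡ 0ℙ → 2 ℕ.∣ n
parity≡0ℙ⇒2∣ zero          _ = ℕ.divides 0 refl
parity≡0ℙ⇒2∣ (suc (suc n)) e = ℕ.∣m∣n⇒∣m+n ℕ.∣-refl (parity≡0ℙ⇒2∣ n e)

module _ (G : Graph) where
  open Graph G

  handshake : ∀ S → sum (degree G S) ≡ ∣ S ∣ + ∣ S ∣
  handshake S = trans (∑-distrib-+ (λ x → ∣ S ∩ tabulate (λ e → does (proj₁ (ends e) ≟ x)) ∣) _)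
    (cong₂ _+_ (sum-fibres (proj₁ ∘ ends) S) (sum-fibres (proj₂ ∘ ends) S))

  -- A common edge would make its tail a common vertex, so vertex-disjoint sets are disjoint and
  -- their sizes add.
  ∣⋃∣-fourCycles : ∀ {Ss} → All (FourCycle G) Ss → AllPairs (VertexDisjoint G) Ss →
                   ∣ ⋃ Ss ∣ ≡ length Ss * 4
  ∣⋃∣-fourCycles [] [] = Subset.∣⊥∣≡0 ∣E∣
  ∣⋃∣-fourCycles {S ∷ Ss} ((_ , ∣S∣≡4) ∷ fours) (S# ∷ disjoint) =
    trans (∣p∪q∣≡∣p∣+∣q∣ S (⋃ Ss) λ (e , e∈) → let e∈S , e∈⋃ = Subset.x∈p∩q⁻ S (⋃ Ss) e∈ in apart S# e∈S e∈⋃)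
      (cong₂ _+_ ∣S∣≡4 (∣⋃∣-fourCycles fours disjoint))
    where
    apart : ∀ {Ss e} → All (VertexDisjoint G S) Ss → e ∈ S → ¬ e ∈ ⋃ Ss
    apart [] _ e∈ = Subset.∉⊥ e∈
    apart {T ∷ Ts} (S#T ∷ S#) e∈S e∈ with Subset.x∈p∪q⁻ T (⋃ Ts) e∈
    ... | inj₁ e∈T = S#T _ (_ , e∈S , inj₁ refl) (_ , e∈T , inj₁ refl)
    ... | inj₂ e∈⋃ = apart S# e∈S e∈⋃

  -- Color classes as perfect matchings

  module _ (bipartition : Bipartite G) where

    private
      side      = proj₁ bipartition
      bipartite = proj₂ bipartition

    -- Only a loop contributes 2 to a degree, and the ends of an edge lie on different sides.
    degree-⁅⁆≤1 : ∀ e x → degree G ⁅ e ⁆ x ≤ 1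
    degree-⁅⁆≤1 e x with proj₁ (ends e) ≟ x
    ... | yes p = begin
      degree G ⁅ e ⁆ x ≤⟨ ℕ.+-mono-≤ (Subset.∣p∩q∣≤∣p∣ ⁅ e ⁆ _) (Subset.p⊆q⇒∣p∣≤∣q∣ no-head) ⟩
      ∣ ⁅ e ⁆ ∣ + ∣ ⊥ {∣E∣} ∣  ≡⟨ cong₂ _+_ (Subset.∣⁅x⁆∣≡1 e) (Subset.∣⊥∣≡0 ∣E∣) ⟩
      1 ∎
      where
      open ℕ.≤-Reasoning
      no-head : ⁅ e ⁆ ∩ tabulate (λ e → does (proj₂ (ends e) ≟ x)) ⊆ ⊥
      no-head e′∈ with Subset.x∈p∩q⁻ ⁅ e ⁆ _ e′∈
      ... | e′∈e , q with Subset.x∈⁅y⁆⇒x≡y e e′∈e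
      ...   | refl = contradiction
        (cong side (trans p (sym (∈-tabulate⁻ (λ e → proj₂ (ends e) ≟ x) q)))) (bipartite e)
    ... | no ¬p = begin
      degree G ⁅ e ⁆ x ≤⟨ ℕ.+-mono-≤ (Subset.p⊆q⇒∣p∣≤∣q∣ no-tail) (Subset.∣p∩q∣≤∣p∣ ⁅ e ⁆ _) ⟩
      ∣ ⊥ {∣E∣} ∣ + ∣ ⁅ e ⁆ ∣ ≡⟨ cong₂ _+_ (Subset.∣⊥∣≡0 ∣E∣) (Subset.∣⁅x⁆∣≡1 e) ⟩
      1 ∎
      where
      open ℕ.≤-Reasoning
      no-tail : ⁅ e ⁆ ∩ tabulate (λ e → does (proj₁ (ends e) ≟ x)) ⊆ ⊥
      no-tail e′∈ with Subset.x∈p∩q⁻ ⁅ e ⁆ _ e′∈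
      ... | e′∈e , q with Subset.x∈⁅y⁆⇒x≡y e e′∈e
      ...   | refl = contradiction (∈-tabulate⁻ (λ e → proj₁ (ends e) ≟ x) q) ¬p

    unique⇒degree≤1 : ∀ {S x} → (∀ {e e′} → e ∈ S → e′ ∈ S → Incident G e x → Incident G e′ x → e ≡ e′) →
                      degree G S x ≤ 1
    unique⇒degree≤1 {S} {x} unique with covers? G S x
    ... | yes (e , e∈S , inc) = ℕ.≤-trans
      (degree-mono-≤ G {S} {⁅ e ⁆} λ inc′ e′∈S →
        subst (_∈ ⁅ e ⁆) (unique e∈S e′∈S inc inc′) (Subset.x∈⁅x⁆ e))
      (degree-⁅⁆≤1 e x)
    ... | no ¬cov = ℕ.≤-trans
      (degree-mono-≤ G {S} {⊥} λ {e} inc e∈S → contradiction (e , e∈S , inc) ¬cov)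
      (ℕ.≤-trans (ℕ.≤-reflexive (degree-⊥ G x)) z≤n)

    module _ (cubic : Cubic G) (col : Coloring G) (proper : Proper G col) where

      private
        class : Fin 3 → EdgeSet G
        class = colorClass G col

        class⁻ : ∀ i {e} → e ∈ class i → col e ≡ i
        class⁻ i = ∈-tabulate⁻ (λ e → col e ≟ i)

      classes-disjoint : ∀ {i j} → i ≢ j → Empty (class i ∩ class j)
      classes-disjoint {i} {j} i≢j (e , e∈) = let p , q = Subset.x∈p∩q⁻ (class i) (class j) e∈ in
        i≢j (trans (sym (class⁻ i p)) (class⁻ j q))

      private
        degree-class≤1 : ∀ i x → degree G (class i) x ≤ 1
        degree-class≤1 i x = unique⇒degree≤1 λ {e} {e′} e∈ e′∈ inc inc′ → same e∈ e′∈ inc inc′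
          where
          same : ∀ {e e′} → e ∈ class i → e′ ∈ class i → Incident G e x → Incident G e′ x → e ≡ e′
          same {e} {e′} e∈ e′∈ inc inc′ with e ≟ e′
          ... | yes eq = eq
          ... | no  ne = contradiction (trans (class⁻ i e∈) (sym (class⁻ i e′∈))) (proper e e′ x ne inc inc′)

        classes-cover : class 0F ∪ (class 1F ∪ class 2F) ≡ ⊤
        classes-cover = Subset.⊆-antisym Subset.⊆⊤ λ {e} _ → cover (col e) refl
          where
          member : ∀ i {e} → col e ≡ i → e ∈ class i
          member i = ∈-tabulate⁺ (λ e → col e ≟ i)
          cover : ∀ {e} i → col e ≡ i → e ∈ class 0F ∪ (class 1F ∪ class 2F)
          cover 0F p = Subset.x∈p∪q⁺ (inj₁ (member 0F p))
          cover 1F p = Subset.x∈p∪q⁺ {p = class 0F} (inj₂ (Subset.x∈p∪q⁺ (inj₁ (member 1F p))))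
          cover 2F p = Subset.x∈p∪q⁺ {p = class 0F}
            (inj₂ (Subset.x∈p∪q⁺ {p = class 1F} (inj₂ (member 2F p))))

        degree-classes : ∀ x → degree G (class 0F) x + (degree G (class 1F) x + degree G (class 2F) x) ≡ 3
        degree-classes x = begin
          degree G (class 0F) x + (degree G (class 1F) x + degree G (class 2F) x)
            ≡⟨ cong (λ d → degree G (class 0F) x + d)
                 (degree-∪ G (class 1F) (class 2F) (classes-disjoint λ ()) x) ⟨
          degree G (class 0F) x + degree G (class 1F ∪ class 2F) x
            ≡⟨ degree-∪ G (class 0F) (class 1F ∪ class 2F) disjoint x ⟨
          degree G (class 0F ∪ (class 1F ∪ class 2F)) x
            ≡⟨ cong (λ S → degree G S x) classes-cover ⟩
          degree G ⊤ x
            ≡⟨ cubic x ⟩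
          3 ∎
          where
          open ≡-Reasoning
          disjoint : Empty (class 0F ∩ (class 1F ∪ class 2F))
          disjoint (e , e∈) with Subset.x∈p∩q⁻ (class 0F) _ e∈
          ... | p , q with Subset.x∈p∪q⁻ (class 1F) (class 2F) q
          ...   | inj₁ q = classes-disjoint {0F} {1F} (λ ()) (e , Subset.x∈p∩q⁺ (p , q))
          ...   | inj₂ q = classes-disjoint {0F} {2F} (λ ()) (e , Subset.x∈p∩q⁺ (p , q))

        all-ones : ∀ {a b c} → a ≤ 1 → b ≤ 1 → c ≤ 1 → a + (b + c) ≡ 3 → a ≡ 1 × b ≡ 1 × c ≡ 1
        all-ones (s≤s z≤n) (s≤s z≤n) (s≤s z≤n) _ = refl , refl , refl
        all-ones z≤n       z≤n       z≤n       ()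
        all-ones z≤n       z≤n       (s≤s z≤n) ()
        all-ones z≤n       (s≤s z≤n) z≤n       ()
        all-ones z≤n       (s≤s z≤n) (s≤s z≤n) ()
        all-ones (s≤s z≤n) z≤n       z≤n       ()
        all-ones (s≤s z≤n) z≤n       (s≤s z≤n) ()
        all-ones (s≤s z≤n) (s≤s z≤n) z≤n       ()

      -- Properness bounds the degree of each color class by 1, and the three degrees add up to 3.
      class-perfect : ∀ i → PerfectMatching G (class i)
      class-perfect i x with all-ones (degree-class≤1 0F x) (degree-class≤1 1F x)
                                 (degree-class≤1 2F x) (degree-classes x)
      class-perfect 0F x | p , _ , _ = p
      class-perfect 1F x | _ , p , _ = p
      class-perfect 2F x | _ , _ , p = p

      parity-faces : ∀ k → ∣V∣ ≡ 2 * k → parity (numberOfFaces (faithfulEmbedding G col)) ≡ parity k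
      parity-faces k ∣V∣≡2k = trans
        (cong parity (trans (length-++ (polygons G col 0F 1F))
          (cong (λ l → length (polygons G col 0F 1F) + l) (length-++ (polygons G col 1F 2F)))))
        (parity-cycles G bipartition (matching 0F) (matching 1F) (matching 2F)
          (classes-disjoint λ ()) (classes-disjoint λ ()) (classes-disjoint λ ()) k ∣V∣≡2k)
        where
        matching : Fin 3 → Matching G
        matching i = class i , class-perfect i

-- The Euler characteristic of an orientable map

module _ (M : GraphMap) where
  open GraphMap M

  private
    V = Graph.∣V∣ C

    degree-v∪f : ∀ x → degree C (v ∪ f) x ≡ 2
    degree-v∪f x = trans (degree-∪ C v f v∩f-empty x) (cong₂ _+_ (v-matching x) (f-matching x))

    disjoint-a : Empty ((v ∪ f) ∩ a)
    disjoint-a (e , e∈) = let e∈vf , e∈a = Subset.x∈p∩q⁻ (v ∪ f) a e∈ in Subset.x∈∁p⇒x∉p e∈a e∈vf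

  a-matching : PerfectMatching C a
  a-matching x = ℕ.+-cancelˡ-≡ 2 _ _ (begin
    2 + degree C a x                   ≡⟨ cong (_+ degree C a x) (degree-v∪f x) ⟨
    degree C (v ∪ f) x + degree C a x  ≡⟨ degree-∪ C (v ∪ f) a disjoint-a x ⟨
    degree C ((v ∪ f) ∪ a) x           ≡⟨ cong (λ S → degree C S x) (Subset.p∪∁p≡⊤ (v ∪ f)) ⟩
    degree C ⊤ x                       ≡⟨ cubic x ⟩
    3                                  ∎)
    where open ≡-Reasoning

  -- Handshaking in the 2-regular set `v ∪ f` equates its number of edges, four per square, with the
  -- number of vertices. The right-hand side has the form `2 * k` with `k` even.
  squares-vertices : V ≡ 2 * (2 * length (proj₁ v∪f-square))
  squares-vertices with v∪f-square
  ... | Ss , fours , disjoint , ⋃Ss≡v∪f = ℕ.*-cancelʳ-≡ V _ 2 (begin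
    V * 2                             ≡⟨ sum-const V 2 ⟨
    sum {V} (λ _ → 2)                 ≡⟨ sum-cong-≗ (λ x → sym (degree-v∪f x)) ⟩
    sum (degree C (v ∪ f))            ≡⟨ handshake C (v ∪ f) ⟩
    ∣ v ∪ f ∣ + ∣ v ∪ f ∣             ≡⟨ cong (λ S → ∣ S ∣ + ∣ S ∣) ⋃Ss≡v∪f ⟨
    ∣ ⋃ Ss ∣ + ∣ ⋃ Ss ∣               ≡⟨ cong (λ s → s + s) (∣⋃∣-fourCycles C fours disjoint) ⟩
    length Ss * 4 + length Ss * 4     ≡⟨ solve 1 (λ s → s :* con 4 :+ s :* con 4 :=
                                            con 2 :* (con 2 :* s) :* con 2) refl (length Ss) ⟩
    2 * (2 * length Ss) * 2           ∎)
    where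
    open ≡-Reasoning
    open ℕ.+-*-Solver

  -- Replacing the minus sign before the number of squares by a plus changes `χ` by twice that
  -- number. The resulting sum is the total number of cycles for the matchings `v`, `f`, `a`, whose
  -- parity is that of half the number of vertices.
  χ-even : Orientable → + 2 ∣ χ
  χ-even orientable = Signed.∣⇒∣ᵤ (subst (Signed._∣_ (+ 2)) χ-sum
    (Signed.∣m∣n⇒∣m-n (Signed.∣ᵤ⇒∣ {+ 2} {+ (s + (t + r))} (parity≡0ℙ⇒2∣ (s + (t + r)) even))
                      (Signed.∣n⇒∣m*n (+ s) {+ 2} Signed.∣-refl)))
    where
    s = length SQ
    t = length fG
    r = length vG
    disjoint-v : Empty (a ∩ v)
    disjoint-v (e , e∈) = let e∈a , e∈v = Subset.x∈p∩q⁻ a v e∈ in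
      disjoint-a (e , Subset.x∈p∩q⁺ (Subset.p⊆p∪q f e∈v , e∈a))
    disjoint-f : Empty (f ∩ a)
    disjoint-f (e , e∈) = let e∈f , e∈a = Subset.x∈p∩q⁻ f a e∈ in
      disjoint-a (e , Subset.x∈p∩q⁺ (Subset.q⊆p∪q v f e∈f , e∈a))
    even : parity (s + (t + r)) ≡ 0ℙ
    even = begin
      parity (s + (t + r))
        -- The matchings are taken in cyclic order, so the third union is `a ∪ v`, whereas `vG` is
        -- defined from `v ∪ a`.
        ≡⟨ cong (λ X → parity (s + (t + length (cyclesIn C X)))) (Subset.∪-comm v a) ⟩
      parity (s + (t + length (cyclesIn C (a ∪ v))))
        ≡⟨ parity-cycles C orientable (v , v-matching) (f , f-matching) (a , a-matching)
             v∩f-empty disjoint-f disjoint-v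
             (2 * length (proj₁ v∪f-square)) squares-vertices ⟩
      parity (2 * length (proj₁ v∪f-square))
        ≡⟨ ℙ.*-homo-* 2 (length (proj₁ v∪f-square)) ⟩
      0ℙ ∎
      where open ≡-Reasoning
    open ℤ.+-*-Solver
    χ-sum : + (s + (t + r)) ℤ.- + s ℤ.* + 2 ≡ χ
    χ-sum = solve 3 (λ s t r → (s :+ (t :+ r)) :- s :* con (+ 2) := (r :- s) :+ t) refl (+ s) (+ t) (+ r)

theorem1p7 : (∀ (G : Graph) (k : ℕ) (col : Coloring G) →
    Cubic G → Bipartite G → Graph.∣V∣ G ≡ 2 * k → Proper G col →
    parity (numberOfFaces (faithfulEmbedding G col)) ≡ parity k)
    × (∀ (M : GraphMap) → GraphMap.Orientable M → + 2 ∣ GraphMap.χ M)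
theorem1p7 =
  (λ G k col cubic bipartite ∣V∣≡2k proper → parity-faces G bipartite cubic col proper k ∣V∣≡2k) ,
  χ-even
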